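{- Let $\kappa$ be a regular uncountable cardinal and $\lambda>\kappa$ a cardinal. If $\lambda\ge\overline{\mathfrak d}_\kappa$ (in particular, if $\lambda\geq\mathfrak d_\kappa$), then it is not the case that $I_{\kappa,\lambda}^+\xrightarrow{\kappa}(I_{\kappa,\lambda}^+,3)^2$.
   Context: For a cardinal $\mu$ and a set $A$, $P_\mu(A)=\{a\subseteq A:|a|<\mu\}$. $I_{\kappa,\lambda}$ is the set of all $A\subseteq P_\kappa(\lambda)$ such that $A\cap\{b\in P_\kappa(\lambda):a\subseteq b\}=\emptyset$ for some $a\in P_\kappa(\lambda)$; $I_{\kappa,\lambda}^+$ is the set of subsets of $P_\kappa(\lambda)$ not in $I_{\kappa,\lambda}$. $\mathfrak d_\kappa$ is the least cardinality of an $X\subseteq{}^\kappa\kappa$ such that for every $g\in{}^\kappa\kappa$ there is $f\in X$ with $g(\alpha)<f(\alpha)$ for all $\alpha<\kappa$. $\overline{\mathfrak d}_\kappa$ is the least cardinality of an $X\subseteq{}^\kappa\kappa$ such that for every $g\in{}^\kappa\kappa$ there is $x\in P_\kappa(X)$ with $g(\alpha)<\bigcup_{f\in x}f(\alpha)$ for all $\alpha<\kappa$. For $A\subseteq P_\kappa(\lambda)$, $[A]^2_\kappa=\{(\bigcup(a\cap\kappa),b):a,b\in A,\ \bigcup(a\cap\kappa)<\bigcup(b\cap\kappa)\}$. For $a,b\in P_\kappa(\lambda)$, $a\prec b$ means $a\subseteq b$ and $\bigcup(a\cap\kappa)<\bigcup(b\cap\kappa)$. $I_{\kappa,\lambda}^+\xrightarrow{\kappa}(I_{\kappa,\lambda}^+,\alpha)^2$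 means: for every $F:[P_\kappa(\lambda)]^2_\kappa\to2$ and every $A\in I_{\kappa,\lambda}^+$ there is $B\subseteq A$ such that either $B\in I_{\kappa,\lambda}^+$ and $F$ is identically $0$ on $[B]^2_\kappa$, or $(B,\prec)$ has order type $\alpha$ and $F$ is identically $1$ on $[B]^2_\kappa$. -}

module Defs where

open import Level using (Level; _⊔_; suc; 0ℓ)
open import Data.Bool.Base using (Bool; true; T)
open import Data.Empty using (⊥)
open import Data.Fin.Base as Fin using (Fin)
import Data.Fin.Induction as Finᵢ
import Data.Fin.Properties as Finₚ
open import Data.Nat.Base using (ℕ)
open import Data.Product.Base using (Σ; Σ-syntax; ∃-syntax; _×_; _,_)
open import Data.Refinement.Base using (Refinement; Refinement-syntax; value)
open import Data.Sum.Base using (_⊎_)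
open import Function.Bundles using (_↣_; _↔_; _⇔_)
open import Induction.WellFounded using (WellFounded)
open import Relation.Binary.Core using (Rel)
open import Relation.Binary.Morphism.Structures using (IsOrderIsomorphism)
open import Relation.Binary.PropositionalEquality.Core using (_≡_)
open import Relation.Binary.Structures using (IsStrictTotalOrder)
open import Relation.Nullary.Negation.Core using (¬_)
open import Relation.Unary using (Pred)

private
  variable
    a b ℓ ℓ' : Level

-- The metatheory is meant to be classical: everything here is used under
-- excluded middle (which, being stated for arbitrary types in Agda, also yields
-- choice) and function extensionality.  Bool-valued maps are then exactly the
-- subsets of a type, and two subsets with the same elements are equal.

𝒫 : Set a → Set a
𝒫 A = A → Bool

infix 4 _∈_ _⊆_

_∈_ : {A : Set a} → A → 𝒫 A → Set
x ∈ X = T (X x)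

_⊆_ : {A : Set a} → 𝒫 A → 𝒫 A → Set a
X ⊆ Y = ∀ x → x ∈ X → x ∈ Y

full : {A : Set a} → 𝒫 A
full _ = true

El : {A : Set a} → 𝒫 A → Set a
El {A = A} X = [ x ∈ A ∣ x ∈ X ]

infix 4 _≼_ _≺ᶜ_

_≼_ : Set a → Set b → Set (a ⊔ b)
A ≼ B = A ↣ B

_≺ᶜ_ : Set a → Set b → Set (a ⊔ b)
A ≺ᶜ B = (A ≼ B) × ¬ (B ≼ A)

-- P_μ(A), where the cardinal μ is given by any type M of cardinality μ.
P[_] : Set ℓ → Set ℓ → Set ℓ
P[ M ] A = [ x ∈ 𝒫 A ∣ El x ≺ᶜ M ]

IsLeastCardinality : {A : Set a} → (𝒫 A → Set ℓ) → Set b → Set (a ⊔ ℓ ⊔ b)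
IsLeastCardinality {A = A} Φ M =
  (Σ[ X ∈ 𝒫 A ] Φ X × (El X ↔ M)) × (∀ X → Φ X → M ≼ El X)

record Ordinal ℓ : Set (suc ℓ) where
  field
    Carrier            : Set ℓ
    _<_                : Rel Carrier ℓ
    isStrictTotalOrder : IsStrictTotalOrder _≡_ _<_
    wellFounded        : WellFounded _<_

finite : ℕ → Ordinal 0ℓ
finite n = record
  { Carrier            = Fin n
  ; _<_                = Fin._<_
  ; isStrictTotalOrder = Finₚ.<-isStrictTotalOrder
  ; wellFounded        = Finᵢ.<-wellFounded
  }

HasOrderType : (A : Set a) → Rel A b → Ordinal ℓ → Set (a ⊔ b ⊔ ℓ)
HasOrderType A _⊏_ α =
  ∃[ f ] IsOrderIsomorphism {A = A} {B = Carrier} _≡_ _≡_ _⊏_ _<_ f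
  where open Ordinal α

-- An element α of a well-order Λ stands for an ordinal below (the order type
-- of) Λ; the von Neumann ordinal α is then the type Seg α of its predecessors.
module Below (Λ : Ordinal ℓ) where

  open Ordinal Λ public

  Seg : Carrier → Set ℓ
  Seg α = [ β ∈ Carrier ∣ β < α ]

  IsCardinalBelow : Carrier → Set ℓ
  IsCardinalBelow κ = ∀ α → α < κ → ¬ (Seg κ ≼ Seg α)

  -- σ = ⋃ S for von Neumann ordinals: β ∈ σ iff β ∈ s for some s ∈ S.
  IsUnion : Pred Carrier ℓ → Carrier → Set ℓ
  IsUnion S σ = ∀ β → (β < σ) ⇔ (∃[ s ] S s × β < s)

record Cardinal ℓ : Set (suc ℓ) where
  field
    ordinal : Ordinal ℓ
  open Below ordinal public
  field
    isInitial : ∀ α → ¬ (Carrier ≼ Seg α)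

∣_∣ : Cardinal ℓ → Set ℓ
∣ μ ∣ = Cardinal.Carrier μ

-- λ is the cardinal Λ, and κ < λ is one of its elements, so that κ ⊆ λ.
module TwoCardinals (Λ : Cardinal ℓ) (κ : ∣ Λ ∣) where

  open Cardinal Λ

  Uncountable : Set ℓ
  Uncountable = ¬ (Seg κ ≼ ℕ)

  Cofinal : 𝒫 (Seg κ) → Set ℓ
  Cofinal X = ∀ (α : Seg κ) → Σ[ β ∈ Seg κ ] β ∈ X × (value α < value β ⊎ α ≡ β)

  -- cf κ = κ
  Regular : Set ℓ
  Regular = IsLeastCardinality Cofinal (Seg κ)

  κ^κ : Set ℓ
  κ^κ = Seg κ → Seg κ

  Dominating : 𝒫 κ^κ → Set ℓ
  Dominating X = ∀ (g : κ^κ) → Σ[ f ∈ κ^κ ] f ∈ X × (∀ α → value (g α) < value (f α))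

  WeaklyDominating : 𝒫 κ^κ → Set ℓ
  WeaklyDominating X =
    ∀ (g : κ^κ) → Σ[ x ∈ P[ Seg κ ] (El X) ] ∀ α →
      ∃[ σ ] IsUnion (λ β → Σ[ f ∈ El X ] f ∈ value x × β ≡ value (value f α)) σ
           × value (g α) < σ

  Is-𝔡 : Cardinal ℓ → Set ℓ
  Is-𝔡 μ = IsLeastCardinality Dominating ∣ μ ∣

  Is-𝔡̄ : Cardinal ℓ → Set ℓ
  Is-𝔡̄ μ = IsLeastCardinality WeaklyDominating ∣ μ ∣

  Pκλ : Set ℓ
  Pκλ = P[ Seg κ ] Carrier

  I : 𝒫 Pκλ → Set ℓ
  I A = Σ[ a ∈ Pκλ ] ∀ b → b ∈ A → value a ⊆ value b → ⊥

  I⁺ : 𝒫 Pκλ → Set ℓ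
  I⁺ A = ¬ I A

  -- σ = ⋃(a ∩ κ)
  IsTrace : Pκλ → Carrier → Set ℓ
  IsTrace a = IsUnion (λ β → β ∈ value a × β < κ)

  TraceLess : Pκλ → Pκλ → Set ℓ
  TraceLess a b = ∃[ σ ] ∃[ τ ] IsTrace a σ × IsTrace b τ × σ < τ

  _≺_ : Rel Pκλ ℓ
  a ≺ b = (value a ⊆ value b) × TraceLess a b

  -- (σ , b) ∈ [A]²_κ; note that a ⊆ b is not required.
  InSquare : 𝒫 Pκλ → Carrier × Pκλ → Set ℓ
  InSquare A (σ , b) =
    Σ[ a ∈ Pκλ ] a ∈ A × b ∈ A × IsTrace a σ × TraceLess a b

  Square : 𝒫 Pκλ → Set ℓ
  Square A = [ p ∈ Carrier × Pκλ ∣ InSquare A p ]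

  ConstantOn : (Square full → Fin 2) → 𝒫 Pκλ → Fin 2 → Set ℓ
  ConstantOn F B i = ∀ p → InSquare B (value p) → F p ≡ i

  -- I⁺_{κ,λ} →^κ (I⁺_{κ,λ} , α)²
  Arrow : Ordinal ℓ' → Set (ℓ ⊔ ℓ')
  Arrow α =
    (F : Square full → Fin 2) (A : 𝒫 Pκλ) → I⁺ A →
    Σ[ B ∈ 𝒫 Pκλ ] B ⊆ A ×
      ( (I⁺ B × ConstantOn F B Fin.zero)
      ⊎ (HasOrderType (El B) (λ a b → value a ≺ value b) α
         × ConstantOn F B (Fin.suc Fin.zero)))

{-# OPTIONS --safe #-}

-- Let X be weakly dominating and code its members by distinct elements of λ.
-- Let A consist of those c such that c ∩ κ has a largest element τ and a second
-- largest element δ, and f δ < τ for every f ∈ X coded in c by an element other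
-- than δ and τ; colour (σ , c) by 1 when δ < σ.  If a ≺ b in A, then ⋃(a ∩ κ) is
-- an element of b ∩ κ other than its maximum, so (⋃(a ∩ κ) , b) has colour 0, and
-- there is not even a 1-homogeneous chain of length 2.  If B ⊆ A is positive, let
-- g send α to some trace ⋃(b ∩ κ) > α with b ∈ B; some c ∈ B codes a family
-- dominating g, so the trace g δ of B lies strictly between δ and τ.

module Submission where

open import Defs
open import Axiom.ExcludedMiddle using (ExcludedMiddle)
open import Axiom.Extensionality.Propositional using (Extensionality)
open import Data.Bool.Base using (Bool; T; false)
open import Data.Bool.Properties using (T?)
open import Data.Empty using (⊥-elim; ⊥-elim-irr)
open import Data.Fin.Base as Fin using (Fin)
open import Data.Irrelevant using ([_])
open import Data.Nat.Base using (s≤s; z≤n)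
open import Data.Product.Base using (Σ; Σ-syntax; ∃-syntax; _×_; _,_; proj₁; proj₂)
open import Data.Refinement.Base using (value; _,_)
open import Data.Refinement.Properties using (value-injective)
open import Data.Sum.Base using (_⊎_; inj₁; inj₂; [_,_]′)
open import Function.Base using (_∘_)
open import Function.Bundles using (Injection; Equivalence; mk↣; mk⇔)
open import Function.Construct.Composition using () renaming (injection to ≼-trans)
open import Function.Properties.Inverse using (Inverse⇒Injection)
open import Relation.Binary.Definitions using (tri<; tri≈; tri>)
open import Relation.Binary.Morphism.Structures using (IsOrderIsomorphism)
open import Relation.Binary.PropositionalEquality.Core using (_≡_; _≢_; refl; sym; trans; cong; subst; subst₂)
open import Relation.Binary.Structures using (IsStrictTotalOrder)
open import Relation.Nullary.Decidable.Core using (Dec; yes; no; recompute; fromWitness; isYes)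
open import Relation.Nullary.Negation.Core using (¬_; contradiction)

-- Subsets and cardinalities under excluded middle.

≺ᶜ-respˡ-≼ : ∀ {a b c} {A : Set a} {B : Set b} {C : Set c} → A ≼ B → B ≺ᶜ C → A ≺ᶜ C
≺ᶜ-respˡ-≼ A≼B (B≼C , C⋠B) = ≼-trans A≼B B≼C , λ C≼A → C⋠B (≼-trans C≼A A≼B)

module _ {ℓ} (em : ExcludedMiddle ℓ) where

  ⟦_⟧ : Set ℓ → Bool
  ⟦ P ⟧ = isYes (em {P})

  ⟦⟧⁺ : ∀ {P} → P → T ⟦ P ⟧
  ⟦⟧⁺ = fromWitness

  -- The argument is irrelevant so that witnesses can be recovered from the irrelevant membership
  -- proofs stored in `El`.
  ⟦⟧⁻ : ∀ {P} → .(T ⟦ P ⟧) → P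
  ⟦⟧⁻ {P} t with em {P}
  ... | yes p = p
  ... | no _  = ⊥-elim-irr t

  insert : {A : Set ℓ} → A → 𝒫 A → 𝒫 A
  insert p X x = ⟦ x ≡ p ⊎ x ∈ X ⟧

  image : {A B : Set ℓ} → (A → B) → 𝒫 A → 𝒫 B
  image f X y = ⟦ Σ[ x ∈ _ ] x ∈ X × f x ≡ y ⟧

  -- A choice of preimages is a right inverse of `f`, hence injective.
  image-≼ : {A B : Set ℓ} (f : A → B) (X : 𝒫 A) → El (image f X) ≼ El X
  image-≼ f X = mk↣ {to = preimage} injective
    where
    preimage : El (image f X) → El X
    preimage (y , [ m ]) = let (x , x∈X , _) = ⟦⟧⁻ m in x , [ x∈X ]

    image-preimage : ∀ y → f (value (preimage y)) ≡ value y
    image-preimage (y , [ m ]) = proj₂ (proj₂ (⟦⟧⁻ m))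

    injective : ∀ {y z} → preimage y ≡ preimage z → y ≡ z
    injective {y} {z} eq = value-injective
      (trans (sym (image-preimage y)) (trans (cong (f ∘ value) eq) (image-preimage z)))

  module _ (Λ : Cardinal ℓ) (κ : ∣ Λ ∣) where

    open Cardinal Λ
    open TwoCardinals Λ κ
    open IsStrictTotalOrder isStrictTotalOrder
      using (compare; irrefl) renaming (trans to <-trans)

    -- Traces of sets whose part below `κ` has a maximum.

    value<κ : (α : Seg κ) → value α < κ
    value<κ (_ , [ α<κ ]) = recompute em α<κ

    IsTrace-unique : ∀ a {σ τ} → IsTrace a σ → IsTrace a τ → σ ≡ τ
    IsTrace-unique a {σ} {τ} isσ isτ with compare σ τ
    ... | tri< σ<τ _ _ = contradiction (from (isσ σ) (to (isτ σ) σ<τ)) (irrefl refl)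
      where open Equivalence
    ... | tri≈ _ σ≡τ _ = σ≡τ
    ... | tri> _ _ τ<σ = contradiction (from (isτ τ) (to (isσ τ) τ<σ)) (irrefl refl)
      where open Equivalence

    record IsTopTwo (c : 𝒫 Carrier) (δ τ : Carrier) : Set ℓ where
      field
        δ∈    : δ ∈ c
        τ∈    : τ ∈ c
        δ<τ   : δ < τ
        τ<κ   : τ < κ
        below : ∀ ξ → ξ ∈ c → ξ < κ → ξ ≢ τ → ξ < δ ⊎ ξ ≡ δ

    -- The union of a set of von Neumann ordinals with a largest element is that element.
    IsTopTwo⇒IsTrace : ∀ (c : Pκλ) {δ τ} → IsTopTwo (value c) δ τ → IsTrace c τ
    IsTopTwo⇒IsTrace c {δ} {τ} top β = mk⇔ (λ β<τ → τ , (τ∈ , τ<κ) , β<τ) bound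
      where
      open IsTopTwo top
      bound : ∃[ ξ ] (ξ ∈ value c × ξ < κ) × β < ξ → β < τ
      bound (ξ , (ξ∈ , ξ<κ) , β<ξ) with em {ξ ≡ τ}
      ... | yes refl = β<ξ
      ... | no ξ≢τ with below ξ ξ∈ ξ<κ ξ≢τ
      ...   | inj₁ ξ<δ  = <-trans (<-trans β<ξ ξ<δ) δ<τ
      ...   | inj₂ refl = <-trans β<ξ δ<τ

    -- Consequences of regularity: bounds and small sets.

    module _ (regular : Regular) (uncountable : Uncountable) where

      κ⋠subsingleton : {Z : Set ℓ} → (∀ (y z : Z) → y ≡ z) → ¬ (Seg κ ≼ Z)
      κ⋠subsingleton eq i =
        uncountable (mk↣ {to = λ _ → 0} (λ _ → Injection.injective i (eq _ _)))

      -- If `α` were maximal, the singleton of `α` would be cofinal, and regularity would embed `κ`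
      -- in it.
      exceeds : (α : Seg κ) → Σ[ β ∈ Seg κ ] value α < value β
      exceeds α with em {Σ[ β ∈ Seg κ ] value α < value β}
      ... | yes larger = larger
      ... | no  maximal = ⊥-elim (κ⋠subsingleton unique (proj₂ regular X cofinal))
        where
        X : 𝒫 (Seg κ)
        X β = ⟦ β ≡ α ⟧

        unique : (β γ : El X) → β ≡ γ
        unique (_ , [ p ]) (_ , [ q ]) = value-injective (trans (⟦⟧⁻ p) (sym (⟦⟧⁻ q)))

        cofinal : Cofinal X
        cofinal β with compare (value β) (value α)
        ... | tri< β<α _ _ = α , ⟦⟧⁺ refl , inj₁ β<α
        ... | tri≈ _ β≡α _ = α , ⟦⟧⁺ refl , inj₂ (value-injective β≡α)
        ... | tri> _ _ α<β = contradiction (β , α<β) maximal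

      -- `R` is the graph of a partial function from `Z` to `κ`, so that it can also describe the
      -- inclusion of `a ∩ κ`. If its range had no strict bound, it would be cofinal; regularity
      -- would embed `κ` in the range, and choosing sources would embed the range in `Z`.
      bounded : {Z : Set ℓ} → ¬ (Seg κ ≼ Z) → (R : Z → Seg κ → Set ℓ) →
                (∀ {z α β} → R z α → R z β → α ≡ β) →
                Σ[ β ∈ Seg κ ] ∀ z α → R z α → value α < value β
      bounded {Z} κ⋠Z R functional
        with em {Σ[ β ∈ Seg κ ] ∀ z α → R z α → value α < value β}
      ... | yes bound = bound
      ... | no  unbounded =
        ⊥-elim (κ⋠Z (≼-trans (proj₂ regular Y cofinal) (mk↣ {to = source} injective)))
        where
        Y : 𝒫 (Seg κ)
        Y α = ⟦ Σ[ z ∈ Z ] R z α ⟧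

        source : El Y → Z
        source (_ , [ m ]) = proj₁ (⟦⟧⁻ m)

        related : ∀ α → R (source α) (value α)
        related (_ , [ m ]) = proj₂ (⟦⟧⁻ m)

        injective : ∀ {α β} → source α ≡ source β → α ≡ β
        injective {α} {β} eq = value-injective
          (functional (related α) (subst (λ z → R z (value β)) (sym eq) (related β)))

        cofinal : Cofinal Y
        cofinal β with em {Σ[ α ∈ Seg κ ] α ∈ Y × (value β < value α ⊎ β ≡ α)}
        ... | yes above = above
        ... | no  none  = contradiction (β , bound) unbounded
          where
          bound : ∀ z α → R z α → value α < value β
          bound z α r with compare (value α) (value β)
          ... | tri< α<β _ _ = α<β
          ... | tri≈ _ α≡β _ =
            contradiction (α , ⟦⟧⁺ (z , r) , inj₂ (value-injective (sym α≡β))) none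
          ... | tri> _ _ β<α = contradiction (α , ⟦⟧⁺ (z , r) , inj₁ β<α) none

      ∅-≺ᶜ : {A : Set ℓ} → El {A = A} (λ _ → false) ≺ᶜ Seg κ
      ∅-≺ᶜ = mk↣ {to = λ z → absurd z} (λ {z} _ → absurd z)
           , κ⋠subsingleton (λ z _ → absurd z)
        where
        absurd : ∀ {w} {W : Set w} {A : Set ℓ} → El {A = A} (λ _ → false) → W
        absurd (_ , [ p ]) = ⊥-elim-irr p

      -- By regularity the injection `j` of `X` into `κ` has bounded range, which leaves the bound
      -- `top` free as the image of `p`.
      insert-≺ᶜ : {A : Set ℓ} (p : A) {X : 𝒫 A} → El X ≺ᶜ Seg κ → El (insert p X) ≺ᶜ Seg κ
      insert-≺ᶜ {A} p {X} (j , κ⋠X) = mk↣ {to = λ z → place z em} (λ {z} {w} → injective z w em em)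
                                     , κ⋠insert
        where
        bound : Σ[ β ∈ Seg κ ] ∀ z α → Injection.to j z ≡ α → value α < value β
        bound = bounded κ⋠X (λ z α → Injection.to j z ≡ α) (λ { refl refl → refl })

        top : Seg κ
        top = proj₁ bound

        j<top : ∀ z → value (Injection.to j z) < value top
        j<top z = proj₂ bound z _ refl

        old : ∀ {x} → x ≢ p → .(x ∈ insert p X) → x ∈ X
        old x≢p m = [ (λ x≡p → contradiction x≡p x≢p) , (λ x∈X → x∈X) ]′ (⟦⟧⁻ m)

        place : (z : El (insert p X)) → Dec (value z ≡ p) → Seg κ
        place z (yes _) = top
        place (x , [ m ]) (no x≢p) = Injection.to j (x , [ old x≢p m ])

        injective : ∀ z w dz dw → place z dz ≡ place w dw → z ≡ w
        injective z w (yes z≡p) (yes w≡p) _ = value-injective (trans z≡p (sym w≡p))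
        injective z w (yes _) (no _) eq = contradiction (j<top _) (irrefl (cong value (sym eq)))
        injective z w (no _) (yes _) eq = contradiction (j<top _) (irrefl (cong value eq))
        injective z w (no _) (no _) eq = value-injective (cong value (Injection.injective j eq))

        -- At most one element of κ is sent to p, so those sent into X are cofinal.
        κ⋠insert : ¬ (Seg κ ≼ El (insert p X))
        κ⋠insert i = κ⋠X (≼-trans (proj₂ regular Y cofinal) (mk↣ {to = restrict} restrict-injective))
          where
          open Injection i using (to)

          Y : 𝒫 (Seg κ)
          Y α = X (value (to α))

          restrict : El Y → El X
          restrict (α , [ m ]) = value (to α) , [ m ]

          restrict-injective : ∀ {α β} → restrict α ≡ restrict β → α ≡ β
          restrict-injective {α} {β} eq = value-injective
            (Injection.injective i (value-injective (cong value {restrict α} {restrict β} eq)))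

          ∈Y : ∀ {α} → value (to α) ≢ p → α ∈ Y
          ∈Y {α} ≢p with to α
          ... | x , [ m ] = old ≢p m

          cofinal : Cofinal Y
          cofinal α with exceeds α
          ... | β , α<β with exceeds β
          ...   | γ , β<γ with em {value (to β) ≡ p}
          ...     | no  β≢p = β , ∈Y β≢p , inj₁ α<β
          ...     | yes β≡p = γ , ∈Y γ≢p , inj₁ (<-trans α<β β<γ)
            where
            γ≢p : value (to γ) ≢ p
            γ≢p γ≡p = irrefl
              (cong value (Injection.injective i (value-injective (trans β≡p (sym γ≡p))))) β<γ

      -- The set `A` and its positivity.

      module _ (X : 𝒫 κ^κ) (code : El X ≼ Carrier)
               (dominate : ∀ (g : κ^κ) → Σ[ x ∈ P[ Seg κ ] (El X) ] ∀ α →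
                 Σ[ f ∈ El X ] f ∈ value x × value (g α) < value (value f α))
        where

        open Injection code using () renaming (to to ⌜_⌝; injective to ⌜⌝-injective)

        -- Codes may lie below `κ`, so `δ` and `τ` can be codes themselves. They are exempt because
        -- otherwise `τ` might have to exceed a value of the very function it codes, which would
        -- make its choice circular.
        ClosedAt : 𝒫 Carrier → Seg κ → Carrier → Set ℓ
        ClosedAt c δ τ =
          ∀ f → ⌜ f ⌝ ∈ c → ⌜ f ⌝ ≢ value δ → ⌜ f ⌝ ≢ τ → value (value f δ) < τ

        InA : Pκλ → Set ℓ
        InA c = Σ[ δ ∈ Seg κ ] Σ[ τ ∈ Carrier ] IsTopTwo (value c) (value δ) τ
                                              × ClosedAt (value c) δ τ

        A : 𝒫 Pκλ
        A c = ⟦ InA c ⟧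

        addTwo : Seg κ → Seg κ → Pκλ → Pκλ
        addTwo δ τ (a , [ small ]) =
          insert (value τ) (insert (value δ) a) , [ insert-≺ᶜ _ (insert-≺ᶜ _ small) ]

        ⊆-addTwo : ∀ δ τ a → value a ⊆ value (addTwo δ τ a)
        ⊆-addTwo δ τ a ξ ξ∈a = ⟦⟧⁺ (inj₂ (⟦⟧⁺ (inj₂ ξ∈a)))

        δ∈addTwo : ∀ δ τ a → value δ ∈ value (addTwo δ τ a)
        δ∈addTwo δ τ a = ⟦⟧⁺ (inj₂ (⟦⟧⁺ (inj₁ refl)))

        τ∈addTwo : ∀ δ τ a → value τ ∈ value (addTwo δ τ a)
        τ∈addTwo δ τ a = ⟦⟧⁺ (inj₁ refl)

        addTwo⁻ : ∀ δ τ a {ξ} → ξ ∈ value (addTwo δ τ a) →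
                  ξ ≢ value δ → ξ ≢ value τ → ξ ∈ value a
        addTwo⁻ δ τ a m ξ≢δ ξ≢τ with ⟦⟧⁻ m
        ... | inj₁ ξ≡τ = contradiction ξ≡τ ξ≢τ
        ... | inj₂ m′ with ⟦⟧⁻ m′
        ...   | inj₁ ξ≡δ = contradiction ξ≡δ ξ≢δ
        ...   | inj₂ ξ∈a = ξ∈a

        κ⋠ : (a : Pκλ) → ¬ (Seg κ ≼ El (value a))
        κ⋠ (a , [ small ]) = proj₂ (recompute em small)

        ∩κ-bounded : (a : Pκλ) → Σ[ δ ∈ Seg κ ] (∀ ξ → ξ ∈ value a → ξ < κ → ξ < value δ)
        ∩κ-bounded a
          with bounded (κ⋠ a) (λ z α → value z ≡ value α)
                 (λ p q → value-injective (trans (sym p) q))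
        ... | δ , <δ = δ , λ ξ ξ∈a ξ<κ → <δ (ξ , [ ξ∈a ]) (ξ , [ ξ<κ ]) refl

        -- Sending the code of `f` to `f δ` is a partial function on `a`, single-valued because the
        -- coding is injective.
        values-bounded : (a : Pκλ) (δ : Seg κ) →
          Σ[ τ ∈ Seg κ ] (∀ f → ⌜ f ⌝ ∈ value a → value (value f δ) < value τ)
        values-bounded a δ
          with bounded (κ⋠ a) (λ z α → Σ[ f ∈ El X ] ⌜ f ⌝ ≡ value z × value f δ ≡ α)
                 (λ { (f , p , refl) (g , q , refl) →
                      cong (λ h → value h δ) (⌜⌝-injective (trans p (sym q))) })
        ... | τ , <τ = τ , λ f f∈a → <τ (⌜ f ⌝ , [ f∈a ]) _ (f , refl , refl)

        exceeds₂ : (α β : Seg κ) → Σ[ γ ∈ Seg κ ] value α < value γ × value β < value γ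
        exceeds₂ α β with compare (value α) (value β) | exceeds α | exceeds β
        ... | tri< α<β _ _ | _ | γ , β<γ = γ , <-trans α<β β<γ , β<γ
        ... | tri≈ _ α≡β _ | _ | γ , β<γ = γ , subst (_< value γ) (sym α≡β) β<γ , β<γ
        ... | tri> _ _ β<α | γ , α<γ | _ = γ , α<γ , <-trans β<α α<γ

        -- Choose `δ` above `a ∩ κ`, then `τ` above `δ` and above all values at `δ` of functions
        -- coded in `a`. Adding both to `a` gives a member of `A`.
        A-positive : I⁺ A
        A-positive (a , avoids) with ∩κ-bounded a
        ... | δ , <δ with values-bounded a δ
        ...   | ρ , <ρ with exceeds₂ δ ρ
        ...     | τ , δ<τ , ρ<τ = avoids c (⟦⟧⁺ (δ , value τ , top , closed)) (⊆-addTwo δ τ a)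
          where
          c : Pκλ
          c = addTwo δ τ a

          below : ∀ ξ → ξ ∈ value c → ξ < κ → ξ ≢ value τ → ξ < value δ ⊎ ξ ≡ value δ
          below ξ ξ∈c ξ<κ ξ≢τ with em {ξ ≡ value δ}
          ... | yes ξ≡δ = inj₂ ξ≡δ
          ... | no  ξ≢δ = inj₁ (<δ ξ (addTwo⁻ δ τ a ξ∈c ξ≢δ ξ≢τ) ξ<κ)

          top : IsTopTwo (value c) (value δ) (value τ)
          top = record { δ∈ = δ∈addTwo δ τ a ; τ∈ = τ∈addTwo δ τ a ; δ<τ = δ<τ
                       ; τ<κ = value<κ τ ; below = below }

          closed : ClosedAt (value c) δ (value τ)
          closed f f∈c ≢δ ≢τ = <-trans (<ρ f (addTwo⁻ δ τ a f∈c ≢δ ≢τ)) ρ<τ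

        -- The colouring, and the absence of chains of colour 1.

        Late : Carrier × Pκλ → Set ℓ
        Late (σ , c) = Σ[ δ ∈ Carrier ] Σ[ τ ∈ Carrier ] IsTopTwo (value c) δ τ × δ < σ

        colour : {P : Set ℓ} → Dec P → Fin 2
        colour (yes _) = Fin.suc Fin.zero
        colour (no _)  = Fin.zero

        colour≡1⇒ : {P : Set ℓ} (P? : Dec P) → colour P? ≡ Fin.suc Fin.zero → P
        colour≡1⇒ (yes p) _ = p

        colour≡0⇒ : {P : Set ℓ} (P? : Dec P) → colour P? ≡ Fin.zero → ¬ P
        colour≡0⇒ (no ¬p) _ = ¬p

        F : Square full → Fin 2
        F p = colour (em {Late (value p)})

        no-1-chain : ∀ {B} → B ⊆ A → ConstantOn F B (Fin.suc Fin.zero) →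
                     ∀ a b → a ∈ B → b ∈ B → ¬ (a ≺ b)
        no-1-chain {B} B⊆A one a b a∈B b∈B (a⊆b , a<b@(σ , ρ , isσ , isρ , σ<ρ))
          with ⟦⟧⁻ {InA a} (B⊆A a a∈B)
        ... | _ , σ′ , top-a , _ with IsTrace-unique a isσ (IsTopTwo⇒IsTrace a top-a)
        ... | refl with colour≡1⇒ em (one ((σ , b) , [ (a , _ , _ , isσ , a<b) ]) (a , a∈B , b∈B , isσ , a<b))
        ... | δ , τ , top-b , δ<σ with IsTrace-unique b isρ (IsTopTwo⇒IsTrace b top-b)
        -- `σ` is the maximum of `a ∩ κ`, so it lies in `b`; being below the maximum of `b ∩ κ`, it
        -- is at most `δ`, against `δ<σ`.
        ... | refl with IsTopTwo.below top-b σ (a⊆b σ (IsTopTwo.τ∈ top-a)) (IsTopTwo.τ<κ top-a)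
                          (λ σ≡τ → irrefl σ≡τ σ<ρ)
        ... | inj₁ σ<δ = irrefl refl (<-trans σ<δ δ<σ)
        ... | inj₂ σ≡δ = irrefl (sym σ≡δ) δ<σ

        -- Positive subsets of `A` are not homogeneous for colour 0.

        pick : ∀ {B} → I⁺ B → (a : Pκλ) → Σ[ b ∈ Pκλ ] b ∈ B × value a ⊆ value b
        pick {B} positive a with em {Σ[ b ∈ Pκλ ] b ∈ B × value a ⊆ value b}
        ... | yes found = found
        ... | no  none  = contradiction (a , λ b b∈B a⊆b → none (b , b∈B , a⊆b)) positive

        traceAbove : ∀ {B} → B ⊆ A → I⁺ B → ∀ α →
          Σ[ σ ∈ Seg κ ] value α < value σ × Σ[ b ∈ Pκλ ] b ∈ B × IsTrace b (value σ)
        traceAbove {B} B⊆A positive α with exceeds α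
        -- Putting `α` itself into `b` would not do, since an element of `b ∩ κ` may equal the
        -- trace; a larger `β` forces the trace above `α`.
        ... | β , α<β with pick positive (insert (value β) (λ _ → false) , [ insert-≺ᶜ _ ∅-≺ᶜ ])
        ... | b , b∈B , β⊆b with ⟦⟧⁻ {InA b} (B⊆A b b∈B)
        ... | δ , τ , top , _ =
          (τ , [ IsTopTwo.τ<κ top ]) , α<τ , b , b∈B , IsTopTwo⇒IsTrace b top
          where
          α<τ : value α < τ
          α<τ = Equivalence.from (IsTopTwo⇒IsTrace b top (value α))
                  (value β , (β⊆b (value β) (⟦⟧⁺ (inj₁ refl)) , value<κ β) , α<β)

        -- The two added ordinals keep δ and τ from being codes of members of a.
        coded-value<τ : ∀ a c η θ {δ τ} → (∀ ξ → ξ ∈ value a → ξ < κ → ξ < value η) →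
          value η < value θ → value (addTwo η θ a) ⊆ value c →
          IsTopTwo (value c) (value δ) τ → ClosedAt (value c) δ τ →
          ∀ f → ⌜ f ⌝ ∈ value a → value (value f δ) < τ
        coded-value<τ a c η θ {δ} {τ} <η η<θ a⁺⊆c top closed f f∈a =
          closed f (a⁺⊆c _ (⊆-addTwo η θ a _ f∈a))
            (λ f≡δ → irrefl f≡δ (f<δ (subst (_< κ) (sym f≡δ) (value<κ δ))))
            (λ f≡τ → irrefl f≡τ (<-trans (f<δ (subst (_< κ) (sym f≡τ) τ<κ)) δ<τ))
          where
          open IsTopTwo top

          η<τ : value η < τ
          η<τ = Equivalence.from (IsTopTwo⇒IsTrace c top (value η))
                  (value θ , (a⁺⊆c _ (τ∈addTwo η θ a) , value<κ θ) , η<θ)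

          -- As `η` lies in `c` below the maximum `τ`, it is at most `δ`, while every code in `a`
          -- that lies in `κ` is below `η`.
          f<δ : ⌜ f ⌝ < κ → ⌜ f ⌝ < value δ
          f<δ f<κ with below (value η) (a⁺⊆c _ (δ∈addTwo η θ a)) (value<κ η)
                         (λ η≡τ → irrefl η≡τ η<τ)
          ... | inj₁ η<δ = <-trans (<η _ f∈a f<κ) η<δ
          ... | inj₂ η≡δ = subst (⌜ f ⌝ <_) η≡δ (<η _ f∈a f<κ)

        codes : P[ Seg κ ] (El X) → Pκλ
        codes (x , [ small ]) = image ⌜_⌝ x , [ ≺ᶜ-respˡ-≼ (image-≼ ⌜_⌝ x) small ]

        ∈codes : ∀ x f → f ∈ value x → ⌜ f ⌝ ∈ value (codes x)
        ∈codes x f f∈x = ⟦⟧⁺ (f , f∈x , refl)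

        -- The small family `x` depends on `g` alone, so a `c` in `B` containing all its codes can
        -- be picked afterwards. Domination at the `δ` of this `c` yields an `f` in `x` with `g δ`
        -- below `f δ`, and `f δ` is below `τ` because `c` is closed.
        fastMember : ∀ {B} → B ⊆ A → I⁺ B → (g : κ^κ) →
          Σ[ c ∈ Pκλ ] c ∈ B × Σ[ δ ∈ Seg κ ] Σ[ τ ∈ Carrier ]
            IsTopTwo (value c) (value δ) τ × value (g δ) < τ
        fastMember B⊆A positive g with dominate g
        ... | x , x-dominates with ∩κ-bounded (codes x)
        ... | η , <η with exceeds η
        ... | θ , η<θ with pick positive (addTwo η θ (codes x))
        ... | c , c∈B , a⁺⊆c with ⟦⟧⁻ {InA c} (B⊆A c c∈B)
        ... | δ , τ , top , closed with x-dominates δ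
        ... | f , f∈x , gδ<fδ = c , c∈B , δ , τ , top , <-trans gδ<fδ
          (coded-value<τ (codes x) c η θ <η η<θ a⁺⊆c top closed f (∈codes x f f∈x))

        -- Membership in the square is a condition on traces: `σ < τ` puts `(σ , c)` into it, and
        -- `δ < σ` gives this pair colour 1.
        late⇒not-0 : ∀ {B} b c {σ δ τ} → b ∈ B → c ∈ B → IsTrace b σ →
          IsTopTwo (value c) δ τ → δ < σ → σ < τ → ¬ ConstantOn F B Fin.zero
        late⇒not-0 b c {σ} {δ} {τ} b∈B c∈B isσ top δ<σ σ<τ zero-on-B =
          colour≡0⇒ (em {Late (σ , c)})
            (zero-on-B ((σ , c) , [ (b , _ , _ , isσ , b<c) ]) (b , b∈B , c∈B , isσ , b<c))
            (δ , τ , top , δ<σ)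
          where
          b<c : TraceLess b c
          b<c = σ , τ , isσ , IsTopTwo⇒IsTrace c top , σ<τ

        not-0-homogeneous : ∀ {B} → B ⊆ A → I⁺ B → ¬ ConstantOn F B Fin.zero
        not-0-homogeneous {B} B⊆A positive = conclude (traceAbove B⊆A positive)
          where
          conclude :
            (∀ α → Σ[ σ ∈ Seg κ ] value α < value σ × Σ[ b ∈ Pκλ ] b ∈ B × IsTrace b (value σ)) →
            ¬ ConstantOn F B Fin.zero
          conclude next =
            let (c , c∈B , δ , τ , top , σ<τ) = fastMember B⊆A positive (λ α → proj₁ (next α))
                (δ<σ , b , b∈B , isσ)         = proj₂ (next δ)
            in late⇒not-0 b c b∈B c∈B isσ top δ<σ σ<τ

        -- Refutation of the arrow relation.

        ¬arrow : ¬ Arrow (finite 3)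
        ¬arrow arrow with arrow F A A-positive
        ... | B , B⊆A , inj₁ (positive , zero-on-B) = not-0-homogeneous B⊆A positive zero-on-B
        ... | B , B⊆A , inj₂ ((h , iso) , one)
          -- The preimages of 0 and 1 already form a forbidden chain `a ≺ b`.
          with IsOrderIsomorphism.surjective iso Fin.zero
             | IsOrderIsomorphism.surjective iso (Fin.suc Fin.zero)
        ... | (a , [ a∈B ]) , h-a | (b , [ b∈B ]) , h-b =
          no-1-chain B⊆A one a b (recompute (T? _) a∈B) (recompute (T? _) b∈B)
            (IsOrderIsomorphism.cancel iso
              (subst₂ Fin._<_ (sym (h-a refl)) (sym (h-b refl)) (s≤s z≤n)))

      -- An ordinal below a union lies below one of its members, so at each `α` a single `f` in `x`
      -- exceeds `g`.
      weaklyDominating⇒¬arrow : ∀ X → El X ≼ Carrier → WeaklyDominating X → ¬ Arrow (finite 3)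
      weaklyDominating⇒¬arrow X code weak = ¬arrow X code λ g →
        let (x , bounds) = weak g in x , λ α →
        let (σ , isUnion , gα<σ) = bounds α
            (_ , (f , f∈x , β≡fα) , gα<β) = Equivalence.to (isUnion _) gα<σ
        in f , f∈x , subst (value (g α) <_) β≡fα gα<β

      -- A single dominating function forms a singleton family, which is small.
      dominating⇒¬arrow : ∀ X → El X ≼ Carrier → Dominating X → ¬ Arrow (finite 3)
      dominating⇒¬arrow X code dom = ¬arrow X code λ g →
        let (f , f∈X , g<f) = dom g
            f′ = f , [ f∈X ]
        in (insert f′ (λ _ → false) , [ insert-≺ᶜ f′ ∅-≺ᶜ ]) , λ α → f′ , ⟦⟧⁺ (inj₁ refl) , g<f α

mainTheorem5 : ∀ {ℓ} → ExcludedMiddle ℓ → Extensionality ℓ ℓ →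
    (Λ : Cardinal ℓ) (κ : ∣ Λ ∣) →
    let open TwoCardinals Λ κ in
    Cardinal.IsCardinalBelow Λ κ → Regular → Uncountable →
    (∀ (𝔡̄ : Cardinal ℓ) → Is-𝔡̄ 𝔡̄ → ∣ 𝔡̄ ∣ ≼ ∣ Λ ∣ → ¬ Arrow (finite 3))
    × (∀ (𝔡 : Cardinal ℓ) → Is-𝔡 𝔡 → ∣ 𝔡 ∣ ≼ ∣ Λ ∣ → ¬ Arrow (finite 3))
mainTheorem5 em _ Λ κ _ regular uncountable =
  -- The family that attains the cardinal is coded in `Λ` through its bijection with that cardinal.
  (λ { _ ((X , weak , X↔𝔡̄) , _) 𝔡̄≼Λ →
       weaklyDominating⇒¬arrow em Λ κ regular uncountable X
         (≼-trans (Inverse⇒Injection X↔𝔡̄) 𝔡̄≼Λ) weak }) ,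
  (λ { _ ((X , dom , X↔𝔡) , _) 𝔡≼Λ →
       dominating⇒¬arrow em Λ κ regular uncountable X
         (≼-trans (Inverse⇒Injection X↔𝔡) 𝔡≼Λ) dom })
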